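{- Let $n\ge1$ be an integer. The identity $$V(p)=V_{D_{n+1}}(p)\cap H\qquad\text{for all }p\in A_n$$ holds if and only if $n\in\{1,2,3\}$.
   Context: Let $\mathbf 1=(1,\dots,1)^T\in\mathbb R^{n+1}$ and $H=\{x\in\mathbb R^{n+1}:x\cdot\mathbf 1=0\}$. The lattice $A_n$ is $\mathbb Z^{n+1}\cap H$, and for $p\in A_n$ its Voronoi cell, taken inside $H$, is $V(p)=\{x\in H:\|x-p\|\le\|x-q\|\text{ for all }q\in A_n\}$. The lattice $D_{n+1}$ is $\{x\in\mathbb Z^{n+1}:x\cdot\mathbf 1\text{ is even}\}$, and for $p\in D_{n+1}$ its Voronoi cell is $V_{D_{n+1}}(p)=\{x\in\mathbb R^{n+1}:\|x-p\|\le\|x-q\|\text{ for all }q\in D_{n+1}\}$. Note $A_n\subset D_{n+1}$. -}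

module Defs where

open import Algebra.Bundles.Raw using (RawMonoid)
open import Algebra.Definitions.RawMonoid as RawMonoidDefs using ()
open import Data.Bool.Base using (if_then_else_)
open import Data.Integer.Base as ℤ using (ℤ; +_)
import Data.Integer.Properties as ℤ
import Data.Integer.Solver as ℤ-Solver
open import Data.Nat.Base as ℕ using (ℕ; zero; suc)
import Data.Nat.Properties as ℕ
open import Data.Product.Base using (_×_; _,_; ∃)
open import Data.Rational.Base as ℚ using (ℚ; 0ℚ; 1ℚ; ½)
import Data.Rational.Properties as ℚ
open import Data.Rational.Solver using (module +-*-Solver)
open import Data.Rational.Unnormalised.Base as ℚᵘ using (ℚᵘ; mkℚᵘ)
import Data.Rational.Unnormalised.Properties as ℚᵘ
open import Data.Sum.Base using (_⊎_; inj₁; inj₂; [_,_]′)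
open import Data.Vec.Functional using (Vector; replicate; zipWith)
open import Level using (0ℓ)
open import Relation.Binary.PropositionalEquality
  using (_≡_; refl; sym; trans; cong; subst; subst₂)
open import Relation.Nullary.Decidable using (Dec; does; yes; no)
open import Relation.Nullary.Negation using (contradiction)
open import Relation.Unary using (Pred; _∈_; _∩_)

open +-*-Solver using (solve; con; _:=_; _:+_; _:*_; :-_; _:-_)

fromℚᵘ-mono-≤ : ∀ {p q} → p ℚᵘ.≤ q → ℚ.fromℚᵘ p ℚ.≤ ℚ.fromℚᵘ q
fromℚᵘ-mono-≤ {p} {q} p≤q = ℚ.toℚᵘ-cancel-≤
  (ℚᵘ.≤-respˡ-≃ (ℚᵘ.≃-sym (ℚ.toℚᵘ-fromℚᵘ p))
    (ℚᵘ.≤-respʳ-≃ (ℚᵘ.≃-sym (ℚ.toℚᵘ-fromℚᵘ q)) p≤q))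

fromℚᵘ-mono-< : ∀ {p q} → p ℚᵘ.< q → ℚ.fromℚᵘ p ℚ.< ℚ.fromℚᵘ q
fromℚᵘ-mono-< {p} {q} p<q = ℚ.toℚᵘ-cancel-<
  (ℚᵘ.<-respˡ-≃ (ℚᵘ.≃-sym (ℚ.toℚᵘ-fromℚᵘ p))
    (ℚᵘ.<-respʳ-≃ (ℚᵘ.≃-sym (ℚ.toℚᵘ-fromℚᵘ q)) p<q))

fromℚᵘ-homo-+ : ∀ p q → ℚ.fromℚᵘ (p ℚᵘ.+ q) ≡ ℚ.fromℚᵘ p ℚ.+ ℚ.fromℚᵘ q
fromℚᵘ-homo-+ p q = ℚ.toℚᵘ-injective
  (ℚᵘ.≃-trans (ℚ.toℚᵘ-fromℚᵘ (p ℚᵘ.+ q))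
    (ℚᵘ.≃-sym (ℚᵘ.≃-trans (ℚ.toℚᵘ-homo-+ (ℚ.fromℚᵘ p) (ℚ.fromℚᵘ q))
      (ℚᵘ.+-cong (ℚ.toℚᵘ-fromℚᵘ p) (ℚ.toℚᵘ-fromℚᵘ q)))))

half>0 : ∀ {ε} → 0ℚ ℚ.< ε → 0ℚ ℚ.< ½ ℚ.* ε
half>0 {ε} 0<ε = ℚ.*-monoʳ-<-pos ½ 0<ε

half+half : ∀ ε → ½ ℚ.* ε ℚ.+ ½ ℚ.* ε ≡ ε
half+half = solve 1 (λ e → con ½ :* e :+ con ½ :* e := e) refl

≤-half+half : ∀ {a b ε} → a ℚ.≤ ½ ℚ.* ε → b ℚ.≤ ½ ℚ.* ε → a ℚ.+ b ℚ.≤ ε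
≤-half+half {ε = ε} p q = subst (_ ℚ.≤_) (half+half ε) (ℚ.+-mono-≤ p q)

p-q≤r⇒p≤q+r : ∀ {p q r} → p ℚ.- q ℚ.≤ r → p ℚ.≤ q ℚ.+ r
p-q≤r⇒p≤q+r {p} {q} {r} h = subst (ℚ._≤ q ℚ.+ r)
  (solve 2 (λ p q → q :+ (p :- q) := p) refl p q) (ℚ.+-monoʳ-≤ q h)

p≤q+r⇒p-q≤r : ∀ {p q r} → p ℚ.≤ q ℚ.+ r → p ℚ.- q ℚ.≤ r
p≤q+r⇒p-q≤r {p} {q} {r} h = subst (p ℚ.- q ℚ.≤_)
  (solve 2 (λ q r → (q :+ r) :- q := r) refl q r) (ℚ.+-monoˡ-≤ (ℚ.- q) h)

p≤∣p∣ : ∀ p → p ℚ.≤ ℚ.∣ p ∣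
p≤∣p∣ p with ℚ.≤-total 0ℚ p
... | inj₁ 0≤p = ℚ.≤-reflexive (sym (ℚ.0≤p⇒∣p∣≡p 0≤p))
... | inj₂ p≤0 = ℚ.≤-trans p≤0 (ℚ.0≤∣p∣ p)

∣-∣-≤ : ∀ {p q r} → p ℚ.≤ q ℚ.+ r → q ℚ.≤ p ℚ.+ r → ℚ.∣ p ℚ.- q ∣ ℚ.≤ r
∣-∣-≤ {p} {q} {r} h₁ h₂ with ℚ.∣p∣≡p∨∣p∣≡-p (p ℚ.- q)
... | inj₁ e = subst (ℚ._≤ r) (sym e) (p≤q+r⇒p-q≤r h₁)
... | inj₂ e = subst (ℚ._≤ r)
  (sym (trans e (solve 2 (λ p q → :- (p :- q) := q :- p) refl p q))) (p≤q+r⇒p-q≤r h₂)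

*-mono-≤ : ∀ {p q r s} → 0ℚ ℚ.≤ q → 0ℚ ℚ.≤ r → p ℚ.≤ q → r ℚ.≤ s → p ℚ.* r ℚ.≤ q ℚ.* s
*-mono-≤ {p} {q} {r} {s} 0≤q 0≤r p≤q r≤s = ℚ.≤-trans
  (ℚ.*-monoʳ-≤-nonNeg r {{ℚ.nonNegative 0≤r}} p≤q)
  (ℚ.*-monoˡ-≤-nonNeg q {{ℚ.nonNegative 0≤q}} r≤s)

-- Reals are Cauchy sequences of rationals; equality of reals is the setoid
-- relation _≈_ below, not _≡_.
Cauchy : (ℕ → ℚ) → Set
Cauchy x = ∀ ε → 0ℚ ℚ.< ε →
  ∃ λ N → ∀ m n → N ℕ.≤ m → N ℕ.≤ n → ℚ.∣ x m ℚ.- x n ∣ ℚ.≤ ε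

record ℝ : Set where
  constructor mkℝ
  field
    seq    : ℕ → ℚ
    cauchy : Cauchy seq

open ℝ public

infix  4 _≈_ _≤_
infix  8 -_
infixl 7 _*_
infixl 6 _+_ _-_

_≈_ : ℝ → ℝ → Set
x ≈ y = ∀ ε → 0ℚ ℚ.< ε → ∃ λ N → ∀ n → N ℕ.≤ n → ℚ.∣ seq x n ℚ.- seq y n ∣ ℚ.≤ ε

_≤_ : ℝ → ℝ → Set
x ≤ y = ∀ ε → 0ℚ ℚ.< ε → ∃ λ N → ∀ n → N ℕ.≤ n → seq x n ℚ.≤ seq y n ℚ.+ ε

fromℚ : ℚ → ℝ
fromℚ q = mkℝ (λ _ → q) λ ε 0<ε → 0 , λ _ _ _ _ →
  subst (λ r → ℚ.∣ r ∣ ℚ.≤ ε) (sym (ℚ.+-inverseʳ q)) (ℚ.<⇒≤ 0<ε)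

fromℤ : ℤ → ℝ
fromℤ k = fromℚ (k ℚ./ 1)

0ℝ 1ℝ : ℝ
0ℝ = fromℚ 0ℚ
1ℝ = fromℚ 1ℚ

_+_ : ℝ → ℝ → ℝ
x + y = mkℝ (λ n → seq x n ℚ.+ seq y n) λ ε 0<ε →
  let M , hx = cauchy x (½ ℚ.* ε) (half>0 0<ε)
      N , hy = cauchy y (½ ℚ.* ε) (half>0 0<ε)
  in M ℕ.⊔ N , λ m n m≥ n≥ →
    subst (λ r → ℚ.∣ r ∣ ℚ.≤ ε)
      (solve 4 (λ a b c d → (a :- c) :+ (b :- d) := (a :+ b) :- (c :+ d)) refl
        (seq x m) (seq y m) (seq x n) (seq y n))
      (ℚ.≤-trans (ℚ.∣p+q∣≤∣p∣+∣q∣ (seq x m ℚ.- seq x n) (seq y m ℚ.- seq y n))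
        (≤-half+half
          (hx m n (ℕ.m⊔n≤o⇒m≤o M N m≥) (ℕ.m⊔n≤o⇒m≤o M N n≥))
          (hy m n (ℕ.m⊔n≤o⇒n≤o M N m≥) (ℕ.m⊔n≤o⇒n≤o M N n≥))))

-_ : ℝ → ℝ
- x = mkℝ (λ n → ℚ.- seq x n) λ ε 0<ε →
  let N , h = cauchy x ε 0<ε
  in N , λ m n m≥ n≥ →
    subst (ℚ._≤ ε)
      (trans (sym (ℚ.∣-p∣≡∣p∣ (seq x m ℚ.- seq x n)))
        (cong ℚ.∣_∣ (solve 2 (λ a b → :- (a :- b) := :- a :- :- b) refl (seq x m) (seq x n))))
      (h m n m≥ n≥)

_-_ : ℝ → ℝ → ℝ
x - y = x + - y

eventually-bounded : ∀ x → ∃ λ B → 0ℚ ℚ.< B ×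
  (∃ λ N → ∀ n → N ℕ.≤ n → ℚ.∣ seq x n ∣ ℚ.≤ B)
eventually-bounded x with cauchy x 1ℚ (ℚ.positive⁻¹ 1ℚ)
... | N , h = ℚ.∣ seq x N ∣ ℚ.+ 1ℚ
  , ℚ.+-mono-≤-< (ℚ.0≤∣p∣ (seq x N)) (ℚ.positive⁻¹ 1ℚ)
  , N , λ n n≥ →
    subst (λ r → ℚ.∣ r ∣ ℚ.≤ ℚ.∣ seq x N ∣ ℚ.+ 1ℚ)
      (solve 2 (λ a b → b :+ (a :- b) := a) refl (seq x n) (seq x N))
      (ℚ.≤-trans (ℚ.∣p+q∣≤∣p∣+∣q∣ (seq x N) (seq x n ℚ.- seq x N))
        (ℚ.+-monoʳ-≤ ℚ.∣ seq x N ∣ (h n N n≥ ℕ.≤-refl)))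

shrink : ∀ B ε → 0ℚ ℚ.< B → 0ℚ ℚ.< ε → ∃ λ δ → 0ℚ ℚ.< δ × B ℚ.* δ ≡ ε
shrink B ε 0<B 0<ε = 1/B ℚ.* ε
  , ℚ.positive⁻¹ (1/B ℚ.* ε) {{ℚ.pos*pos⇒pos 1/B {{ℚ.1/pos⇒pos B}} ε {{ℚ.positive 0<ε}}}}
  , trans (sym (ℚ.*-assoc B 1/B ε))
      (trans (cong (ℚ._* ε) (ℚ.*-inverseʳ B)) (ℚ.*-identityˡ ε))
  where
  instance
    B-pos : ℚ.Positive B
    B-pos = ℚ.positive 0<B
    B-nonZero : ℚ.NonZero B
    B-nonZero = ℚ.pos⇒nonZero B
  1/B = ℚ.1/ B

*-cauchy : ∀ x y → Cauchy (λ n → seq x n ℚ.* seq y n)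
*-cauchy x y ε 0<ε =
  let B , 0<B , K , hB = eventually-bounded x
      C , 0<C , L , hC = eventually-bounded y
      δ , 0<δ , Bδ = shrink B (½ ℚ.* ε) 0<B (half>0 0<ε)
      η , 0<η , Cη = shrink C (½ ℚ.* ε) 0<C (half>0 0<ε)
      M , hx = cauchy x η 0<η
      N , hy = cauchy y δ 0<δ
      hK : ∀ {m} → (K ℕ.⊔ L) ℕ.⊔ (M ℕ.⊔ N) ℕ.≤ m → K ℕ.≤ m
      hK m≥ = ℕ.m⊔n≤o⇒m≤o K L (ℕ.m⊔n≤o⇒m≤o (K ℕ.⊔ L) (M ℕ.⊔ N) m≥)
      hL : ∀ {m} → (K ℕ.⊔ L) ℕ.⊔ (M ℕ.⊔ N) ℕ.≤ m → L ℕ.≤ m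
      hL m≥ = ℕ.m⊔n≤o⇒n≤o K L (ℕ.m⊔n≤o⇒m≤o (K ℕ.⊔ L) (M ℕ.⊔ N) m≥)
      hM : ∀ {m} → (K ℕ.⊔ L) ℕ.⊔ (M ℕ.⊔ N) ℕ.≤ m → M ℕ.≤ m
      hM m≥ = ℕ.m⊔n≤o⇒m≤o M N (ℕ.m⊔n≤o⇒n≤o (K ℕ.⊔ L) (M ℕ.⊔ N) m≥)
      hN : ∀ {m} → (K ℕ.⊔ L) ℕ.⊔ (M ℕ.⊔ N) ℕ.≤ m → N ℕ.≤ m
      hN m≥ = ℕ.m⊔n≤o⇒n≤o M N (ℕ.m⊔n≤o⇒n≤o (K ℕ.⊔ L) (M ℕ.⊔ N) m≥)
  in (K ℕ.⊔ L) ℕ.⊔ (M ℕ.⊔ N) , λ m n m≥ n≥ →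
    let a = seq x m ; b = seq y m ; c = seq x n ; d = seq y n in
    subst (λ r → ℚ.∣ r ∣ ℚ.≤ ε)
      (solve 4 (λ a b c d → a :* (b :- d) :+ d :* (a :- c) := a :* b :- c :* d) refl a b c d)
      (ℚ.≤-trans (ℚ.∣p+q∣≤∣p∣+∣q∣ (a ℚ.* (b ℚ.- d)) (d ℚ.* (a ℚ.- c)))
        (≤-half+half
          (subst₂ ℚ._≤_ (sym (ℚ.∣p*q∣≡∣p∣*∣q∣ a (b ℚ.- d))) Bδ
            (*-mono-≤ (ℚ.<⇒≤ 0<B) (ℚ.0≤∣p∣ (b ℚ.- d))
              (hB m (hK m≥)) (hy m n (hN m≥) (hN n≥))))
          (subst₂ ℚ._≤_ (sym (ℚ.∣p*q∣≡∣p∣*∣q∣ d (a ℚ.- c))) Cη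
            (*-mono-≤ (ℚ.<⇒≤ 0<C) (ℚ.0≤∣p∣ (a ℚ.- c))
              (hC n (hL n≥)) (hx m n (hM m≥) (hM n≥))))))

_*_ : ℝ → ℝ → ℝ
x * y = mkℝ (λ n → seq x n ℚ.* seq y n) (*-cauchy x y)

sq : ℚ → ℚ
sq p = p ℚ.* p

-- The largest k ≤ b with (k/(n+1))² ≤ q, or 0 if there is none.
isqrt : ℕ → ℚ → ℕ → ℕ
isqrt n q zero    = 0
isqrt n q (suc b) =
  if does (sq (+ suc b ℚ./ suc n) ℚ.≤? q) then suc b else isqrt n q b

-- If k > (1 + ∣ ↥ q ∣) (n+1) then (k/(n+1))² > q, so this bound on the search
-- is no restriction, and sqrtℚ n q is √(max(q,0)) rounded down to a multiple
-- of 1/(n+1).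
sqrt-bound : ℕ → ℚ → ℕ
sqrt-bound n q = suc ℤ.∣ ℚ.↥ q ∣ ℕ.* suc n

sqrtℚ : ℕ → ℚ → ℚ
sqrtℚ n q = + isqrt n q (sqrt-bound n q) ℚ./ suc n

grid : ℕ → ℕ → ℚ
grid n k = + k ℚ./ suc n

grid-suc : ∀ n k → grid n (suc k) ≡ grid n k ℚ.+ grid n 1
grid-suc n k = trans
  (ℚ.fromℚᵘ-cong {mkℚᵘ (+ suc k) n} {mkℚᵘ (+ k) n ℚᵘ.+ mkℚᵘ (+ 1) n} (ℚᵘ.*≡* eq))
  (fromℚᵘ-homo-+ (mkℚᵘ (+ k) n) (mkℚᵘ (+ 1) n))
  where
  module Z = ℤ-Solver.+-*-Solver
  eq : + suc k ℤ.* + (suc n ℕ.* suc n)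
     ≡ (+ k ℤ.* + suc n ℤ.+ + 1 ℤ.* + suc n) ℤ.* + suc n
  eq = trans (cong (+ suc k ℤ.*_) (ℤ.pos-* (suc n) (suc n)))
    (Z.solve 2 (λ k s → (Z.con (+ 1) Z.:+ k) Z.:* (s Z.:* s)
      Z.:= (k Z.:* s Z.:+ Z.con (+ 1) Z.:* s) Z.:* s) refl (+ k) (+ suc n))

0≤grid : ∀ n k → 0ℚ ℚ.≤ grid n k
0≤grid n k = ℚ.nonNegative⁻¹ (grid n k) {{ℚ.normalize-nonNeg k (suc n)}}

0≤sq-grid : ∀ n k → 0ℚ ℚ.≤ sq (grid n k)
0≤sq-grid n k = *-mono-≤ (0≤grid n k) ℚ.≤-refl (0≤grid n k) (0≤grid n k)

bound : ∀ n q → q ℚ.< sq (grid n (suc (sqrt-bound n q)))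
bound n q@(ℚ.mkℚ i d _) = ℚ.<-≤-trans q<c (ℚ.≤-trans c≤c² (*-mono-≤
    (0≤grid n (suc b)) 0≤c c≤g c≤g))
  where
  c b : _
  b = suc ℤ.∣ i ∣ ℕ.* suc n
  c = + suc ℤ.∣ i ∣ ℚ./ 1
  0≤c : 0ℚ ℚ.≤ c
  0≤c = 0≤grid 0 (suc ℤ.∣ i ∣)
  1≤c : 1ℚ ℚ.≤ c
  1≤c = fromℚᵘ-mono-≤ {mkℚᵘ (+ 1) 0} {mkℚᵘ (+ suc ℤ.∣ i ∣) 0}
    (ℚᵘ.*≤* (ℤ.*-monoʳ-≤-nonNeg (+ 1) {+ 1} {+ suc ℤ.∣ i ∣} (ℤ.+≤+ (ℕ.s≤s ℕ.z≤n))))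
  c≤c² : c ℚ.≤ sq c
  c≤c² = subst (ℚ._≤ sq c) (ℚ.*-identityˡ c) (ℚ.*-monoʳ-≤-nonNeg c {{ℚ.nonNegative 0≤c}} 1≤c)
  i≤ : ∀ j → j ℤ.≤ + ℤ.∣ j ∣
  i≤ (+ _) = ℤ.≤-refl
  i≤ ℤ.-[1+ _ ] = ℤ.-≤+
  i<c : i ℤ.* + 1 ℤ.< + suc ℤ.∣ i ∣ ℤ.* + suc d
  i<c = ℤ.≤-<-trans (ℤ.≤-reflexive (ℤ.*-identityʳ i))
    (ℤ.≤-<-trans (i≤ i) (subst (+ ℤ.∣ i ∣ ℤ.<_) (ℤ.pos-* (suc ℤ.∣ i ∣) (suc d))
      (ℤ.+<+ (ℕ.m≤m*n (suc ℤ.∣ i ∣) (suc d)))))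
  q<c : q ℚ.< c
  q<c = subst (ℚ._< c) (ℚ.fromℚᵘ-toℚᵘ q)
    (fromℚᵘ-mono-< {mkℚᵘ i d} {mkℚᵘ (+ suc ℤ.∣ i ∣) 0} (ℚᵘ.*<* i<c))
  c≤g : c ℚ.≤ grid n (suc b)
  c≤g = fromℚᵘ-mono-≤ {mkℚᵘ (+ suc ℤ.∣ i ∣) 0} {mkℚᵘ (+ suc b) n}
    (ℚᵘ.*≤* (subst₂ ℤ._≤_ (ℤ.pos-* (suc ℤ.∣ i ∣) (suc n)) (sym (ℤ.*-identityʳ (+ suc b)))
      (ℤ.+≤+ (ℕ.n≤1+n b))))

isqrt-lower : ∀ n q b → 0ℚ ℚ.≤ q → sq (grid n (isqrt n q b)) ℚ.≤ q
isqrt-lower n q zero 0≤q =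
  subst (λ r → sq r ℚ.≤ q) (sym (ℚ.0/n≡0 (suc n))) 0≤q
isqrt-lower n q (suc b) 0≤q = go (sq (grid n (suc b)) ℚ.≤? q)
  where
  go : (d : Dec (sq (grid n (suc b)) ℚ.≤ q)) →
    sq (grid n (if does d then suc b else isqrt n q b)) ℚ.≤ q
  go (yes h) = h
  go (no  _) = isqrt-lower n q b 0≤q

isqrt-negative : ∀ n q b → q ℚ.< 0ℚ → isqrt n q b ≡ 0
isqrt-negative n q zero    q<0 = refl
isqrt-negative n q (suc b) q<0 = go (sq (grid n (suc b)) ℚ.≤? q)
  where
  go : (d : Dec (sq (grid n (suc b)) ℚ.≤ q)) →
    (if does d then suc b else isqrt n q b) ≡ 0
  go (yes h) = contradiction
    (ℚ.<-≤-trans q<0 (ℚ.≤-trans (0≤sq-grid n (suc b)) h)) (ℚ.<-irrefl refl)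
  go (no  _) = isqrt-negative n q b q<0

isqrt-upper : ∀ n q b → q ℚ.< sq (grid n (suc b)) → q ℚ.< sq (grid n (suc (isqrt n q b)))
isqrt-upper n q zero    h = h
isqrt-upper n q (suc b) h = go (sq (grid n (suc b)) ℚ.≤? q)
  where
  go : (d : Dec (sq (grid n (suc b)) ℚ.≤ q)) →
    q ℚ.< sq (grid n (suc (if does d then suc b else isqrt n q b)))
  go (yes _) = h
  go (no h′) = isqrt-upper n q b (ℚ.≰⇒> h′)

0≤sqrtℚ : ∀ n q → 0ℚ ℚ.≤ sqrtℚ n q
0≤sqrtℚ n q = 0≤grid n (isqrt n q (sqrt-bound n q))

sqrtℚ-lower : ∀ n q → sq (sqrtℚ n q) ℚ.≤ q ⊎ (q ℚ.< 0ℚ × sqrtℚ n q ≡ 0ℚ)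
sqrtℚ-lower n q = go (0ℚ ℚ.≤? q)
  where
  go : Dec (0ℚ ℚ.≤ q) → sq (sqrtℚ n q) ℚ.≤ q ⊎ (q ℚ.< 0ℚ × sqrtℚ n q ≡ 0ℚ)
  go (yes 0≤q) = inj₁ (isqrt-lower n q (sqrt-bound n q) 0≤q)
  go (no  0≰q) = inj₂ (ℚ.≰⇒> 0≰q ,
    trans (cong (grid n) (isqrt-negative n q (sqrt-bound n q) (ℚ.≰⇒> 0≰q))) (ℚ.0/n≡0 (suc n)))

sqrtℚ-upper : ∀ n q → q ℚ.< sq (sqrtℚ n q ℚ.+ grid n 1)
sqrtℚ-upper n q = subst (λ r → q ℚ.< sq r) (grid-suc n (isqrt n q (sqrt-bound n q)))
  (isqrt-upper n q (sqrt-bound n q) (bound n q))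

grid-small : ∀ ε → 0ℚ ℚ.< ε → ∃ λ N → ∀ n → N ℕ.≤ n → grid n 1 ℚ.≤ ε
grid-small (ℚ.mkℚ (+ zero) d _) 0<ε = contradiction (ℚ.positive 0<ε) λ ()
grid-small (ℚ.mkℚ ℤ.-[1+ _ ] d _) 0<ε = contradiction (ℚ.positive 0<ε) λ ()
grid-small ε@(ℚ.mkℚ (+ suc p) d _) 0<ε = d , λ n d≤n →
  subst (grid n 1 ℚ.≤_) (ℚ.fromℚᵘ-toℚᵘ ε)
    (fromℚᵘ-mono-≤ {mkℚᵘ (+ 1) n} {mkℚᵘ (+ suc p) d}
      (ℚᵘ.*≤* (subst₂ ℤ._≤_ (ℤ.pos-* 1 (suc d)) (ℤ.pos-* (suc p) (suc n))
        (ℤ.+≤+ (ℕ.*-mono-≤ (ℕ.s≤s (ℕ.z≤n {p})) (ℕ.s≤s d≤n))))))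

sq-cancel-≤ : ∀ {p q} → 0ℚ ℚ.≤ q → sq p ℚ.≤ sq q → p ℚ.≤ q
sq-cancel-≤ {p} {q} 0≤q p²≤q² with p ℚ.≤? q
... | yes p≤q = p≤q
... | no  p≰q = contradiction
  (ℚ.≤-<-trans p²≤q² (ℚ.≤-<-trans
    (ℚ.*-monoˡ-≤-nonNeg q {{ℚ.nonNegative 0≤q}} (ℚ.<⇒≤ q<p))
    (ℚ.*-monoˡ-<-pos p {{ℚ.positive (ℚ.≤-<-trans 0≤q q<p)}} q<p)))
  (ℚ.<-irrefl refl)
  where q<p = ℚ.≰⇒> p≰q

sq-close : ∀ a b s p q e → 0ℚ ℚ.≤ b → 0ℚ ℚ.≤ s → 0ℚ ℚ.≤ e →
  sq a ℚ.≤ p → q ℚ.< sq (b ℚ.+ s) → s ℚ.≤ e → p ℚ.≤ q ℚ.+ sq e →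
  a ℚ.≤ b ℚ.+ (e ℚ.+ e)
sq-close a b s p q e 0≤b 0≤s 0≤e a²≤p q<[b+s]² s≤e p≤ = sq-cancel-≤ 0≤b+2e (begin
  sq a                                 ≤⟨ a²≤p ⟩
  p                                    ≤⟨ p≤ ⟩
  q ℚ.+ sq e                           ≤⟨ ℚ.+-monoˡ-≤ (sq e) (ℚ.<⇒≤ q<[b+s]²) ⟩
  sq (b ℚ.+ s) ℚ.+ sq e                ≤⟨ ℚ.+-monoˡ-≤ (sq e) (*-mono-≤ 0≤b+e 0≤b+s b+s≤b+e b+s≤b+e) ⟩
  sq (b ℚ.+ e) ℚ.+ sq e                ≡⟨ ℚ.+-identityʳ _ ⟨
  sq (b ℚ.+ e) ℚ.+ sq e ℚ.+ 0ℚ         ≤⟨ ℚ.+-monoʳ-≤ (sq (b ℚ.+ e) ℚ.+ sq e) (ℚ.+-mono-≤ 0≤t 0≤t) ⟩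
  sq (b ℚ.+ e) ℚ.+ sq e ℚ.+ (t ℚ.+ t)  ≡⟨ solve 2 (λ b e →
    (b :+ e) :* (b :+ e) :+ e :* e :+ (e :* (b :+ e) :+ e :* (b :+ e))
      := (b :+ (e :+ e)) :* (b :+ (e :+ e))) refl b e ⟩
  sq (b ℚ.+ (e ℚ.+ e))                 ∎)
  where
  open ℚ.≤-Reasoning
  t = e ℚ.* (b ℚ.+ e)
  0≤b+s : 0ℚ ℚ.≤ b ℚ.+ s
  0≤b+s = ℚ.+-mono-≤ 0≤b 0≤s
  0≤b+e : 0ℚ ℚ.≤ b ℚ.+ e
  0≤b+e = ℚ.+-mono-≤ 0≤b 0≤e
  0≤b+2e : 0ℚ ℚ.≤ b ℚ.+ (e ℚ.+ e)
  0≤b+2e = ℚ.+-mono-≤ 0≤b (ℚ.+-mono-≤ 0≤e 0≤e)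
  b+s≤b+e : b ℚ.+ s ℚ.≤ b ℚ.+ e
  b+s≤b+e = ℚ.+-monoʳ-≤ b s≤e
  0≤t : 0ℚ ℚ.≤ t
  0≤t = *-mono-≤ 0≤e ℚ.≤-refl 0≤e 0≤b+e

sq-upper : ∀ a s q B δ → 0ℚ ℚ.≤ s → 0ℚ ℚ.≤ B ℚ.+ B ℚ.+ 1ℚ → a ℚ.≤ B → s ℚ.≤ 1ℚ → s ℚ.≤ δ →
  q ℚ.< sq (a ℚ.+ s) → q ℚ.≤ sq a ℚ.+ (B ℚ.+ B ℚ.+ 1ℚ) ℚ.* δ
sq-upper a s q B δ 0≤s 0≤C a≤B s≤1 s≤δ q<[a+s]² = begin
  q                                ≤⟨ ℚ.<⇒≤ q<[a+s]² ⟩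
  sq (a ℚ.+ s)                     ≡⟨ solve 2 (λ a s →
    (a :+ s) :* (a :+ s) := a :* a :+ (a :+ a :+ s) :* s) refl a s ⟩
  sq a ℚ.+ (a ℚ.+ a ℚ.+ s) ℚ.* s   ≤⟨ ℚ.+-monoʳ-≤ (sq a)
    (*-mono-≤ 0≤C 0≤s (ℚ.+-mono-≤ (ℚ.+-mono-≤ a≤B a≤B) s≤1) s≤δ) ⟩
  sq a ℚ.+ (B ℚ.+ B ℚ.+ 1ℚ) ℚ.* δ  ∎
  where open ℚ.≤-Reasoning

sqrtℚ-close : ∀ m n p q e → 0ℚ ℚ.≤ e → grid n 1 ℚ.≤ e → p ℚ.≤ q ℚ.+ sq e →
  sqrtℚ m p ℚ.≤ sqrtℚ n q ℚ.+ (e ℚ.+ e)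
sqrtℚ-close m n p q e 0≤e s≤e p≤ = [ positive , negative ]′ (sqrtℚ-lower m p)
  where
  positive : sq (sqrtℚ m p) ℚ.≤ p → sqrtℚ m p ℚ.≤ sqrtℚ n q ℚ.+ (e ℚ.+ e)
  positive a²≤p = sq-close (sqrtℚ m p) (sqrtℚ n q) (grid n 1) p q e
    (0≤sqrtℚ n q) (0≤grid n 1) 0≤e a²≤p (sqrtℚ-upper n q) s≤e p≤
  negative : p ℚ.< 0ℚ × sqrtℚ m p ≡ 0ℚ → sqrtℚ m p ℚ.≤ sqrtℚ n q ℚ.+ (e ℚ.+ e)
  negative (_ , a≡0) = subst (ℚ._≤ sqrtℚ n q ℚ.+ (e ℚ.+ e)) (sym a≡0)
    (ℚ.+-mono-≤ {0ℚ} {sqrtℚ n q} {0ℚ} {e ℚ.+ e} (0≤sqrtℚ n q)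
      (ℚ.+-mono-≤ {0ℚ} {e} {0ℚ} {e} 0≤e 0≤e))

sqrt-cauchy : ∀ x → Cauchy (λ n → sqrtℚ n (seq x n))
sqrt-cauchy x ε 0<ε =
  let e = ½ ℚ.* ε
      0<e = half>0 0<ε
      M , hx = cauchy x (sq e)
        (ℚ.positive⁻¹ (sq e) {{ℚ.pos*pos⇒pos e {{ℚ.positive 0<e}} e {{ℚ.positive 0<e}}}})
      N , hs = grid-small e 0<e
      close : ∀ m n → M ℕ.⊔ N ℕ.≤ m → M ℕ.⊔ N ℕ.≤ n →
        sqrtℚ m (seq x m) ℚ.≤ sqrtℚ n (seq x n) ℚ.+ ε
      close m n m≥ n≥ = subst (λ r → sqrtℚ m (seq x m) ℚ.≤ sqrtℚ n (seq x n) ℚ.+ r)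
        (half+half ε)
        (sqrtℚ-close m n (seq x m) (seq x n) e (ℚ.<⇒≤ 0<e)
          (hs n (ℕ.m⊔n≤o⇒n≤o M N n≥))
          (p-q≤r⇒p≤q+r {seq x m} {seq x n} (ℚ.≤-trans (p≤∣p∣ (seq x m ℚ.- seq x n))
            (hx m n (ℕ.m⊔n≤o⇒m≤o M N m≥) (ℕ.m⊔n≤o⇒m≤o M N n≥)))))
  in M ℕ.⊔ N , λ m n m≥ n≥ →
    ∣-∣-≤ {sqrtℚ m (seq x m)} {sqrtℚ n (seq x n)} (close m n m≥ n≥) (close n m n≥ m≥)

infix 8 √_

-- On negative reals √ is 0.
√_ : ℝ → ℝ
√ x = mkℝ (λ n → sqrtℚ n (seq x n)) (sqrt-cauchy x)

0≤√ : ∀ x → 0ℝ ≤ √ x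
0≤√ x ε 0<ε = 0 , λ n _ →
  ℚ.+-mono-≤ {0ℚ} {sqrtℚ n (seq x n)} {0ℚ} {ε} (0≤sqrtℚ n (seq x n)) (ℚ.<⇒≤ 0<ε)

√-square : ∀ x → 0ℝ ≤ x → √ x * √ x ≈ x
√-square x 0≤x ε 0<ε =
  let B , 0<B , K , hB = eventually-bounded (√ x)
      0<C = ℚ.+-mono-< {0ℚ} {B ℚ.+ B} {0ℚ} {1ℚ} (ℚ.+-mono-< {0ℚ} {B} {0ℚ} {B} 0<B 0<B) (ℚ.positive⁻¹ 1ℚ)
      δ , 0<δ , Cδ = shrink (B ℚ.+ B ℚ.+ 1ℚ) ε 0<C 0<ε
      L , hδ = grid-small δ 0<δ
      M , h1 = grid-small 1ℚ (ℚ.positive⁻¹ 1ℚ)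
      N , h0 = 0≤x ε 0<ε
      k≥ : ∀ {n} → (K ℕ.⊔ L) ℕ.⊔ (M ℕ.⊔ N) ℕ.≤ n → K ℕ.≤ n
      k≥ n≥ = ℕ.m⊔n≤o⇒m≤o K L (ℕ.m⊔n≤o⇒m≤o (K ℕ.⊔ L) (M ℕ.⊔ N) n≥)
      l≥ : ∀ {n} → (K ℕ.⊔ L) ℕ.⊔ (M ℕ.⊔ N) ℕ.≤ n → L ℕ.≤ n
      l≥ n≥ = ℕ.m⊔n≤o⇒n≤o K L (ℕ.m⊔n≤o⇒m≤o (K ℕ.⊔ L) (M ℕ.⊔ N) n≥)
      m≥ : ∀ {n} → (K ℕ.⊔ L) ℕ.⊔ (M ℕ.⊔ N) ℕ.≤ n → M ℕ.≤ n
      m≥ n≥ = ℕ.m⊔n≤o⇒m≤o M N (ℕ.m⊔n≤o⇒n≤o (K ℕ.⊔ L) (M ℕ.⊔ N) n≥)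
      n≥′ : ∀ {n} → (K ℕ.⊔ L) ℕ.⊔ (M ℕ.⊔ N) ℕ.≤ n → N ℕ.≤ n
      n≥′ n≥ = ℕ.m⊔n≤o⇒n≤o M N (ℕ.m⊔n≤o⇒n≤o (K ℕ.⊔ L) (M ℕ.⊔ N) n≥)
  in (K ℕ.⊔ L) ℕ.⊔ (M ℕ.⊔ N) , λ n n≥ → ∣-∣-≤
    {sq (sqrtℚ n (seq x n))} {seq x n}
    (lower n (h0 n (n≥′ n≥)))
    (upper n B δ (ℚ.<⇒≤ 0<C) (hB n (k≥ n≥)) (hδ n (l≥ n≥)) (h1 n (m≥ n≥)) Cδ)
  where
  lower : ∀ n → 0ℚ ℚ.≤ seq x n ℚ.+ ε → sq (sqrtℚ n (seq x n)) ℚ.≤ seq x n ℚ.+ ε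
  lower n 0≤q+ε = [ positive , negative ]′ (sqrtℚ-lower n (seq x n))
    where
    positive : sq (sqrtℚ n (seq x n)) ℚ.≤ seq x n → sq (sqrtℚ n (seq x n)) ℚ.≤ seq x n ℚ.+ ε
    positive a²≤q = ℚ.≤-trans a²≤q
      (subst (ℚ._≤ seq x n ℚ.+ ε) (ℚ.+-identityʳ _) (ℚ.+-monoʳ-≤ (seq x n) (ℚ.<⇒≤ 0<ε)))
    negative : seq x n ℚ.< 0ℚ × sqrtℚ n (seq x n) ≡ 0ℚ → sq (sqrtℚ n (seq x n)) ℚ.≤ seq x n ℚ.+ ε
    negative (_ , a≡0) = subst (λ r → sq r ℚ.≤ seq x n ℚ.+ ε) (sym a≡0) 0≤q+ε

  upper : ∀ n B δ → 0ℚ ℚ.≤ B ℚ.+ B ℚ.+ 1ℚ → ℚ.∣ sqrtℚ n (seq x n) ∣ ℚ.≤ B →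
    grid n 1 ℚ.≤ δ → grid n 1 ℚ.≤ 1ℚ → (B ℚ.+ B ℚ.+ 1ℚ) ℚ.* δ ≡ ε →
    seq x n ℚ.≤ sq (sqrtℚ n (seq x n)) ℚ.+ ε
  upper n B δ 0≤C ∣a∣≤B s≤δ s≤1 Cδ =
    subst (λ r → seq x n ℚ.≤ sq (sqrtℚ n (seq x n)) ℚ.+ r) Cδ
      (sq-upper (sqrtℚ n (seq x n)) (grid n 1) (seq x n) B δ (0≤grid n 1) 0≤C
        (ℚ.≤-trans (p≤∣p∣ (sqrtℚ n (seq x n))) ∣a∣≤B) s≤1 s≤δ (sqrtℚ-upper n (seq x n)))

+-rawMonoid : RawMonoid 0ℓ 0ℓ
+-rawMonoid = record { _≈_ = _≈_ ; _∙_ = _+_ ; ε = 0ℝ }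

open RawMonoidDefs +-rawMonoid public using (sum)

infix  9 ℝ^_
infixl 7 _·_
infixl 6 _-ᵥ_

ℝ^_ : ℕ → Set
ℝ^ m = Vector ℝ m

_-ᵥ_ : ∀ {m} → ℝ^ m → ℝ^ m → ℝ^ m
_-ᵥ_ = zipWith _-_

_·_ : ∀ {m} → ℝ^ m → ℝ^ m → ℝ
x · y = sum (zipWith _*_ x y)

‖_‖ : ∀ {m} → ℝ^ m → ℝ
‖ x ‖ = √ (x · x)

𝟏 : ∀ {m} → ℝ^ m
𝟏 = replicate _ 1ℝ

ℤ^_ : ∀ m → Pred (ℝ^ m) 0ℓ
(ℤ^ m) x = ∃ λ (z : Vector ℤ m) → ∀ i → x i ≈ fromℤ (z i)

-- The ambient space of H, A and V is ℝ^(n+1); that of D and V-D is ℝ^m.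
H : ∀ n → Pred (ℝ^ suc n) 0ℓ
H n x = x · 𝟏 ≈ 0ℝ

A : ∀ n → Pred (ℝ^ suc n) 0ℓ
A n = (ℤ^ suc n) ∩ H n

D : ∀ m → Pred (ℝ^ m) 0ℓ
D m x = x ∈ ℤ^ m × ∃ λ (k : ℤ) → x · 𝟏 ≈ fromℤ (+ 2 ℤ.* k)

V : ∀ n → ℝ^ suc n → Pred (ℝ^ suc n) 0ℓ
V n p x = x ∈ H n × (∀ q → q ∈ A n → ‖ x -ᵥ p ‖ ≤ ‖ x -ᵥ q ‖)

V-D : ∀ m → ℝ^ m → Pred (ℝ^ m) 0ℓ
V-D m p x = ∀ q → q ∈ D m → ‖ x -ᵥ p ‖ ≤ ‖ x -ᵥ q ‖

{-# OPTIONS --safe #-}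
module Submission where

-- Let q be a point of D with coordinate sum 2s, and subtract s from q on two
-- coordinates: the result lies in A. Averaging the square distance from x ∈ H
-- over uniformly distributed pairs of coordinates changes it by
-- (2 - 8/(n+1)) s², which is not positive exactly when n + 1 ≤ 4; hence some
-- point of A is as close to x as q is. For n ≥ 4 and p = 0 the point
-- x = e₀ + e₁ - c 𝟏 of H, c = 2/(n+1), lies in V(0) because z² ± z ≥ 0 for
-- integers z, but since c < ½ it is closer to e₀ + e₁ ∈ D than to 0.

open import Defs using (A; H; V; V-D)
open import Data.Nat.Base using (ℕ; suc; _≥_)
open import Data.Sum.Base using (_⊎_)
open import Function.Bundles using (_⇔_)
open import Relation.Binary.PropositionalEquality using (_≡_)
open import Relation.Unary using (_∈_; _∩_; _≐_)

open import Defs using (ℝ; seq; eventually-bounded; shrink; half>0; half+half;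
  p≤∣p∣; p-q≤r⇒p≤q+r; ∣-∣-≤; fromℚᵘ-mono-≤; fromℚᵘ-homo-+; 0≤grid; grid-small;
  sqrtℚ; sqrtℚ-close; 0≤sqrtℚ; √-square; sum; fromℚ; fromℤ; 0ℝ; 1ℝ; 𝟏; D;
  _≈_; _≤_; _+_; _*_; -_; _-_; √_; ‖_‖; ℝ^_; ℤ^_; _·_; _-ᵥ_)
import Defs
open import Data.Bool.Base using (Bool; true; false; if_then_else_)
open import Data.Fin.Base using (Fin; zero; suc)
open import Data.Integer.Base as ℤ using (ℤ; +_; -[1+_])
import Data.Integer.Properties as ℤ
import Data.Integer.Solver as ℤ-Solver
import Data.Nat.Base as ℕ
import Data.Nat.Properties as ℕ
open import Data.Product.Base using (_×_; _,_; ∃; proj₁)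
open import Data.Rational.Base as ℚ using (ℚ; 0ℚ; 1ℚ; ½)
import Data.Rational.Properties as ℚ
open import Data.Rational.Solver using (module +-*-Solver)
open import Data.Rational.Unnormalised.Base as ℚᵘ using (mkℚᵘ)
open import Data.Sum.Base using (inj₁; inj₂)
open import Data.Vec.Functional using (Vector; replicate; zipWith; foldr; []; _∷_)
open import Function.Base using (_∘_)
open import Function.Bundles using (mk⇔)
open import Level using (0ℓ)
open import Relation.Binary.Bundles using (Poset)
open import Relation.Binary.PropositionalEquality
  using (refl; sym; trans; cong; cong₂; subst; subst₂)
import Relation.Binary.Reasoning.PartialOrder as PartialOrderReasoning
open import Relation.Nullary.Negation using (¬_; contradiction)
open import Relation.Unary using (_⊆_)

open +-*-Solver using (Polynomial; solve; con; _:=_; _:+_; _:*_; :-_; _:-_)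

-- Order and equality of Cauchy reals.

Eventually : (ℕ → Set) → Set
Eventually P = ∃ λ N → ∀ n → N ℕ.≤ n → P n

Eventually-map : ∀ {P Q : ℕ → Set} → (∀ n → P n → Q n) → Eventually P → Eventually Q
Eventually-map f (N , p) = N , λ n n≥ → f n (p n n≥)

Eventually-zip : ∀ {P Q R : ℕ → Set} → (∀ n → P n → Q n → R n) →
  Eventually P → Eventually Q → Eventually R
Eventually-zip f (M , p) (N , q) = M ℕ.⊔ N , λ n n≥ →
  f n (p n (ℕ.m⊔n≤o⇒m≤o M N n≥)) (q n (ℕ.m⊔n≤o⇒n≤o M N n≥))

-- The relations _≤_ and _≈_ unfold to statements about the sequences alone, so
-- real arguments cannot be inferred from them and are explicit below.
pointwise-≤ : ∀ x y → (∀ n → seq x n ℚ.≤ seq y n) → x ≤ y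
pointwise-≤ x y h ε 0<ε = 0 , λ n _ →
  ℚ.≤-trans (h n) (subst (ℚ._≤ seq y n ℚ.+ ε) (ℚ.+-identityʳ (seq y n)) (ℚ.+-monoʳ-≤ (seq y n) (ℚ.<⇒≤ 0<ε)))

≤-antisym : ∀ x y → x ≤ y → y ≤ x → x ≈ y
≤-antisym x y h k ε 0<ε = Eventually-zip (λ n → ∣-∣-≤) (h ε 0<ε) (k ε 0<ε)

pointwise-≈ : ∀ x y → (∀ n → seq x n ≡ seq y n) → x ≈ y
pointwise-≈ x y h = ≤-antisym x y (pointwise-≤ x y (ℚ.≤-reflexive ∘ h))
  (pointwise-≤ y x (ℚ.≤-reflexive ∘ sym ∘ h))

≈-refl : ∀ x → x ≈ x
≈-refl x = pointwise-≈ x x λ _ → refl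

≈-sym : ∀ x y → x ≈ y → y ≈ x
≈-sym x y h ε 0<ε = Eventually-map
  (λ n → subst (ℚ._≤ ε) (trans (sym (ℚ.∣-p∣≡∣p∣ (seq x n ℚ.- seq y n)))
    (cong ℚ.∣_∣ (solve 2 (λ p q → :- (p :- q) := q :- p) refl (seq x n) (seq y n)))))
  (h ε 0<ε)

≈⇒≤ : ∀ x y → x ≈ y → x ≤ y
≈⇒≤ x y h ε 0<ε = Eventually-map
  (λ n ∣d∣≤ε → p-q≤r⇒p≤q+r (ℚ.≤-trans (p≤∣p∣ (seq x n ℚ.- seq y n)) ∣d∣≤ε)) (h ε 0<ε)

≈⇒≥ : ∀ x y → x ≈ y → y ≤ x
≈⇒≥ x y h = ≈⇒≤ y x (≈-sym x y h)

≤-trans : ∀ x y z → x ≤ y → y ≤ z → x ≤ z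
≤-trans x y z h k ε 0<ε = Eventually-zip
  (λ n p q → subst (seq x n ℚ.≤_)
    (trans (ℚ.+-assoc (seq z n) (½ ℚ.* ε) (½ ℚ.* ε)) (cong (seq z n ℚ.+_) (half+half ε)))
    (ℚ.≤-trans p (ℚ.+-monoˡ-≤ (½ ℚ.* ε) q)))
  (h _ (half>0 0<ε)) (k _ (half>0 0<ε))

≈-trans : ∀ x y z → x ≈ y → y ≈ z → x ≈ z
≈-trans x y z h k = ≤-antisym x z
  (≤-trans x y z (≈⇒≤ x y h) (≈⇒≤ y z k)) (≤-trans z y x (≈⇒≥ y z k) (≈⇒≥ x y h))

≤-poset : Poset 0ℓ 0ℓ 0ℓ
≤-poset = record
  { Carrier = ℝ ; _≈_ = _≈_ ; _≤_ = _≤_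
  ; isPartialOrder = record
    { isPreorder = record
      { isEquivalence = record
        { refl  = λ {x} → ≈-refl x
        ; sym   = λ {x} {y} → ≈-sym x y
        ; trans = λ {x} {y} {z} → ≈-trans x y z
        }
      ; reflexive = λ {x} {y} → ≈⇒≤ x y
      ; trans     = λ {x} {y} {z} → ≤-trans x y z
      }
    ; antisym = λ {x} {y} → ≤-antisym x y
    }
  }

module ≤-Reasoning = PartialOrderReasoning ≤-poset

-- Compatibility of order and equality with arithmetic.

+-mono-≤ : ∀ x y u v → x ≤ y → u ≤ v → x + u ≤ y + v
+-mono-≤ x y u v h k ε 0<ε = Eventually-zip
  (λ n p q → subst (seq x n ℚ.+ seq u n ℚ.≤_)
    (trans (solve 3 (λ a b e → (a :+ e) :+ (b :+ e) := (a :+ b) :+ (e :+ e)) refl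
      (seq y n) (seq v n) (½ ℚ.* ε)) (cong ((seq y n ℚ.+ seq v n) ℚ.+_) (half+half ε)))
    (ℚ.+-mono-≤ p q))
  (h _ (half>0 0<ε)) (k _ (half>0 0<ε))

+-cong : ∀ x y u v → x ≈ y → u ≈ v → x + u ≈ y + v
+-cong x y u v h k = ≤-antisym (x + u) (y + v)
  (+-mono-≤ x y u v (≈⇒≤ x y h) (≈⇒≤ u v k)) (+-mono-≤ y x v u (≈⇒≥ x y h) (≈⇒≥ u v k))

+-congˡ : ∀ z x y → x ≈ y → z + x ≈ z + y
+-congˡ z x y = +-cong z z x y (≈-refl z)

neg-cong : ∀ x y → x ≈ y → - x ≈ - y
neg-cong x y h ε 0<ε = Eventually-map
  (λ n → subst (ℚ._≤ ε) (trans (sym (ℚ.∣-p∣≡∣p∣ (seq x n ℚ.- seq y n)))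
    (cong ℚ.∣_∣ (solve 2 (λ p q → :- (p :- q) := :- p :- :- q) refl (seq x n) (seq y n)))))
  (h ε 0<ε)

*-comm : ∀ x y → x * y ≈ y * x
*-comm x y = pointwise-≈ (x * y) (y * x) λ n → ℚ.*-comm (seq x n) (seq y n)

*-congˡ : ∀ z x y → x ≈ y → z * x ≈ z * y
*-congˡ z x y h ε 0<ε =
  let B , 0<B , bounded = eventually-bounded z
      δ , 0<δ , Bδ≡ε = shrink B ε 0<B 0<ε
  in Eventually-zip
    (λ n ∣z∣≤B ∣d∣≤δ → subst₂ ℚ._≤_
      (trans (sym (ℚ.∣p*q∣≡∣p∣*∣q∣ (seq z n) (seq x n ℚ.- seq y n)))
        (cong ℚ.∣_∣ (solve 3 (λ r p q → r :* (p :- q) := r :* p :- r :* q) refl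
          (seq z n) (seq x n) (seq y n))))
      Bδ≡ε
      (Defs.*-mono-≤ (ℚ.<⇒≤ 0<B) (ℚ.0≤∣p∣ (seq x n ℚ.- seq y n)) ∣z∣≤B ∣d∣≤δ))
    bounded (h δ 0<δ)

*-cong : ∀ x y u v → x ≈ y → u ≈ v → x * u ≈ y * v
*-cong x y u v h k = ≈-trans (x * u) (x * v) (y * v) (*-congˡ x u v k)
  (≈-trans (x * v) (v * x) (y * v) (*-comm x v)
    (≈-trans (v * x) (v * y) (y * v) (*-congˡ v x y h) (*-comm v y)))

-- Nonnegativity is asked of every term of `z`: from `0ℝ ≤ z` alone a term could be slightly
-- negative, and the inequality could not be multiplied index by index. The terms of a square root
-- are nonnegative by construction.
*-monoˡ-≤ : ∀ z x y → (∀ n → 0ℚ ℚ.≤ seq z n) → x ≤ y → z * x ≤ z * y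
*-monoˡ-≤ z x y 0≤z h ε 0<ε =
  let B , 0<B , bounded = eventually-bounded z
      δ , 0<δ , Bδ≡ε = shrink B ε 0<B 0<ε
      open ℚ.≤-Reasoning
  in Eventually-zip
    (λ n ∣z∣≤B x≤y+δ → begin
      seq z n ℚ.* seq x n                  ≤⟨
        ℚ.*-monoˡ-≤-nonNeg (seq z n) {{ℚ.nonNegative (0≤z n)}} x≤y+δ ⟩
      seq z n ℚ.* (seq y n ℚ.+ δ)          ≡⟨ ℚ.*-distribˡ-+ (seq z n) (seq y n) δ ⟩
      seq z n ℚ.* seq y n ℚ.+ seq z n ℚ.* δ  ≤⟨ ℚ.+-monoʳ-≤ (seq z n ℚ.* seq y n)
        (ℚ.*-monoʳ-≤-nonNeg δ {{ℚ.nonNegative (ℚ.<⇒≤ 0<δ)}} (ℚ.≤-trans (p≤∣p∣ (seq z n)) ∣z∣≤B)) ⟩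
      seq z n ℚ.* seq y n ℚ.+ B ℚ.* δ        ≡⟨ cong (seq z n ℚ.* seq y n ℚ.+_) Bδ≡ε ⟩
      seq z n ℚ.* seq y n ℚ.+ ε              ∎)
    bounded (h δ 0<δ)

*-cancelˡ-≤ : ∀ c .{{_ : ℚ.Positive c}} x y → fromℚ c * x ≤ fromℚ c * y → x ≤ y
*-cancelˡ-≤ c x y h ε 0<ε = Eventually-map
  (λ n p → ℚ.*-cancelˡ-≤-pos c
    (subst (c ℚ.* seq x n ℚ.≤_) (sym (ℚ.*-distribˡ-+ c (seq y n) ε)) p))
  (h (c ℚ.* ε) (ℚ.positive⁻¹ (c ℚ.* ε) {{ℚ.pos*pos⇒pos c ε {{ℚ.positive 0<ε}}}}))

-- Square roots and norms.

-- The hypothesis is used with tolerance e², because √(q + e²) ≤ √q + e for q ≥ 0; rounding to the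
-- grid costs another e, which gives 2e = ε in all.
√-mono-≤ : ∀ x y → x ≤ y → √ x ≤ √ y
√-mono-≤ x y h ε 0<ε =
  let e = ½ ℚ.* ε
      0<e = half>0 0<ε
  in Eventually-zip
    (λ n s≤e x≤y → subst (λ r → sqrtℚ n (seq x n) ℚ.≤ sqrtℚ n (seq y n) ℚ.+ r) (half+half ε)
      (sqrtℚ-close n n (seq x n) (seq y n) e (ℚ.<⇒≤ 0<e) s≤e x≤y))
    (grid-small e 0<e)
    (h (Defs.sq e) (ℚ.positive⁻¹ (Defs.sq e) {{ℚ.pos*pos⇒pos e {{ℚ.positive 0<e}} e {{ℚ.positive 0<e}}}}))

√-cancel-≤ : ∀ x y → 0ℝ ≤ x → 0ℝ ≤ y → √ x ≤ √ y → x ≤ y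
√-cancel-≤ x y 0≤x 0≤y h = begin
  x            ≈⟨ √-square x 0≤x ⟨
  √ x * √ x    ≤⟨ *-monoˡ-≤ (√ x) (√ x) (√ y) (λ n → 0≤sqrtℚ n (seq x n)) h ⟩
  √ x * √ y    ≈⟨ *-comm (√ x) (√ y) ⟩
  √ y * √ x    ≤⟨ *-monoˡ-≤ (√ y) (√ x) (√ y) (λ n → 0≤sqrtℚ n (seq y n)) h ⟩
  √ y * √ y    ≈⟨ √-square y 0≤y ⟩
  y            ∎
  where open ≤-Reasoning

0≤p² : ∀ p → 0ℚ ℚ.≤ p ℚ.* p
0≤p² p = subst (0ℚ ℚ.≤_) ∣p²∣≡p² (ℚ.0≤∣p∣ (p ℚ.* p))
  where
  ∣p²∣≡p² : ℚ.∣ p ℚ.* p ∣ ≡ p ℚ.* p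
  ∣p²∣≡p² with ℚ.∣p∣≡p∨∣p∣≡-p p
  ... | inj₁ e = trans (ℚ.∣p*q∣≡∣p∣*∣q∣ p p) (cong₂ ℚ._*_ e e)
  ... | inj₂ e = trans (ℚ.∣p*q∣≡∣p∣*∣q∣ p p)
    (trans (cong₂ ℚ._*_ e e) (solve 1 (λ p → :- p :* :- p := p :* p) refl p))

sum-mono-≤ : ∀ {m} (x y : ℝ^ m) → (∀ i → x i ≤ y i) → sum x ≤ sum y
sum-mono-≤ {ℕ.zero} x y h = pointwise-≤ 0ℝ 0ℝ λ _ → ℚ.≤-refl
sum-mono-≤ {suc m}  x y h = +-mono-≤ (x zero) (y zero) (sum (x ∘ suc)) (sum (y ∘ suc))
  (h zero) (sum-mono-≤ (x ∘ suc) (y ∘ suc) (h ∘ suc))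

0≤x·x : ∀ {m} (x : ℝ^ m) n → 0ℚ ℚ.≤ seq (x · x) n
0≤x·x {ℕ.zero} x n = ℚ.≤-refl
0≤x·x {suc m}  x n = ℚ.+-mono-≤ (0≤p² (seq (x zero) n)) (0≤x·x (x ∘ suc) n)

-- Together with `‖‖-cancel-≤` this trades the norms in the definition of a Voronoi cell for squared
-- distances, which are polynomial in the coordinates.
‖‖-mono-≤ : ∀ {m} (x y : ℝ^ m) → x · x ≤ y · y → ‖ x ‖ ≤ ‖ y ‖
‖‖-mono-≤ x y = √-mono-≤ (x · x) (y · y)

‖‖-cancel-≤ : ∀ {m} (x y : ℝ^ m) → ‖ x ‖ ≤ ‖ y ‖ → x · x ≤ y · y
‖‖-cancel-≤ x y = √-cancel-≤ (x · x) (y · y)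
  (pointwise-≤ 0ℝ (x · x) (0≤x·x x)) (pointwise-≤ 0ℝ (y · y) (0≤x·x y))

-- Integer vectors, shifts and finite sums.

/1-homo-+ : ∀ i j → (i ℤ.+ j) ℚ./ 1 ≡ i ℚ./ 1 ℚ.+ j ℚ./ 1
/1-homo-+ i j = trans
  (ℚ.fromℚᵘ-cong {mkℚᵘ (i ℤ.+ j) 0} {mkℚᵘ i 0 ℚᵘ.+ mkℚᵘ j 0} (ℚᵘ.*≡*
    (cong (ℤ._* + 1) (cong₂ ℤ._+_ (sym (ℤ.*-identityʳ i)) (sym (ℤ.*-identityʳ j))))))
  (fromℚᵘ-homo-+ (mkℚᵘ i 0) (mkℚᵘ j 0))

fromℤ-+ : ∀ i j → fromℤ (i ℤ.+ j) ≈ fromℤ i + fromℤ j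
fromℤ-+ i j = pointwise-≈ (fromℤ (i ℤ.+ j)) (fromℤ i + fromℤ j) λ _ → /1-homo-+ i j

A⊆D : ∀ n → A n ⊆ D (suc n)
A⊆D n (z , h) = z , + 0 , h

-- `u` is the indicator of the coordinates that move. With two of them and t = - s, a point of D
-- with coordinate sum 2s is carried into A.
shift : ∀ {m} → ℝ → Vector Bool m → ℝ^ m → ℝ^ m
shift t u q i = q i + (if u i then t else 0ℝ)

shift-integral : ∀ {m} j (u : Vector Bool m) {q} → q ∈ ℤ^ m → shift (fromℤ j) u q ∈ ℤ^ m
shift-integral j u {q} (z , q≈z) = (λ i → z i ℤ.+ (if u i then j else + 0)) , λ i →
  let open ≤-Reasoning in begin-equality
  q i + (if u i then fromℤ j else 0ℝ)          ≈⟨ +-cong (q i) (fromℤ (z i)) (if u i then fromℤ j else 0ℝ)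
    (fromℤ (if u i then j else + 0)) (q≈z i) (if-fromℤ (u i)) ⟩
  fromℤ (z i) + fromℤ (if u i then j else + 0) ≈⟨ fromℤ-+ (z i) (if u i then j else + 0) ⟨
  fromℤ (z i ℤ.+ (if u i then j else + 0))     ∎
  where
  if-fromℤ : ∀ b → (if b then fromℤ j else 0ℝ) ≈ fromℤ (if b then j else + 0)
  if-fromℤ true  = ≈-refl (fromℤ j)
  if-fromℤ false = pointwise-≈ 0ℝ (fromℤ (+ 0)) λ _ → refl

-- Turns a sum of variable length into a product that the ring solver can treat with m as an atom.
sum-const : ∀ {m} (x : ℝ^ m) j p → (∀ i → seq (x i) j ≡ p) → seq (sum x) j ≡ (+ m ℚ./ 1) ℚ.* p
sum-const {ℕ.zero} x j p h = sym (ℚ.*-zeroˡ p)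
sum-const {suc m}  x j p h = trans
  (cong₂ ℚ._+_ (h zero) (sum-const (λ i → x (suc i)) j p (λ i → h (suc i))))
  (trans (solve 2 (λ p r → p :+ r :* p := (con 1ℚ :+ r) :* p) refl p (+ m ℚ./ 1))
    (cong (ℚ._* p) (sym (/1-homo-+ (+ 1) (+ m)))))

-- The shape of all sums in the counterexample, whose vectors distinguish only the first two
-- coordinates.
sum-const₂ : ∀ {m} (x : ℝ^ suc (suc m)) j p r →
  seq (x zero) j ≡ p → seq (x (suc zero)) j ≡ p → (∀ i → seq (x (suc (suc i))) j ≡ r) →
  seq (sum x) j ≡ p ℚ.+ (p ℚ.+ (+ m ℚ./ 1) ℚ.* r)
sum-const₂ x j p r h₀ h₁ h =
  cong₂ ℚ._+_ h₀ (cong₂ ℚ._+_ h₁ (sum-const (λ i → x (suc (suc i))) j r h))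

*-zeroʳ-≈ : ∀ x y → y ≈ 0ℝ → x * y ≈ 0ℝ
*-zeroʳ-≈ x y h = ≈-trans (x * y) (x * 0ℝ) 0ℝ (*-congˡ x y 0ℝ h)
  (pointwise-≈ (x * 0ℝ) 0ℝ λ n → ℚ.*-zeroʳ (seq x n))

2s-s-s≈0 : ∀ s → fromℤ (+ 2 ℤ.* s) + fromℤ (ℤ.- s) + fromℤ (ℤ.- s) ≈ 0ℝ
2s-s-s≈0 s = begin-equality
  fromℤ (+ 2 ℤ.* s) + fromℤ (ℤ.- s) + fromℤ (ℤ.- s)  ≈⟨ +-cong (fromℤ (+ 2 ℤ.* s ℤ.- s))
    (fromℤ (+ 2 ℤ.* s) + fromℤ (ℤ.- s)) (fromℤ (ℤ.- s)) (fromℤ (ℤ.- s))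
    (fromℤ-+ (+ 2 ℤ.* s) (ℤ.- s)) (≈-refl (fromℤ (ℤ.- s))) ⟨
  fromℤ (+ 2 ℤ.* s ℤ.- s) + fromℤ (ℤ.- s)            ≈⟨ fromℤ-+ (+ 2 ℤ.* s ℤ.- s) (ℤ.- s) ⟨
  fromℤ (+ 2 ℤ.* s ℤ.- s ℤ.- s)                      ≡⟨ cong fromℤ
    (Z.solve 1 (λ s → Z.con (+ 2) Z.:* s Z.:- s Z.:- s Z.:= Z.con (+ 0)) refl s) ⟩
  0ℝ                                                 ∎
  where
  open ≤-Reasoning
  module Z = ℤ-Solver.+-*-Solver

-- Inclusions between the cells; averaging for n ≤ 3.

-- Holds in every dimension: since A ⊆ D, the cell of D is cut out by more inequalities.
V-D∩H⊆V : ∀ n p → (V-D (suc n) p ∩ H n) ⊆ V n p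
V-D∩H⊆V n p (x∈V-D , x∈H) = x∈H , λ q q∈A → x∈V-D q (A⊆D n {q} q∈A)

-- With t = - s the factor q · 𝟏 + t + t - x · 𝟏 of r vanishes, so c ≥ 0 says that
-- the mean square distance to the shifted points is at most that to q.
averaging : ∀ {n k} (u : Fin (suc k) → Vector Bool (suc n)) (c r : ℚ) → 0ℚ ℚ.≤ c →
  (∀ i q t j → seq (shift t (u i) q · 𝟏) j ≡ seq (q · 𝟏 + t + t) j) →
  (∀ x q t j →
    seq (sum (λ i → (x -ᵥ shift t (u i) q) · (x -ᵥ shift t (u i) q)) + fromℚ c * (t * t)) j
    ≡ seq (fromℤ (+ suc k) * ((x -ᵥ q) · (x -ᵥ q)) + fromℚ r * (t * (q · 𝟏 + t + t - x · 𝟏))) j) →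
  ∀ p → V n p ⊆ V-D (suc n) p
averaging {n} {k} u c r 0≤c weight mean p {x} (x∈H , x∈V) q (q∈ℤ , s , q·𝟏≈2s) =
  ‖‖-mono-≤ (x -ᵥ p) (x -ᵥ q) (*-cancelˡ-≤ (+ suc k ℚ./ 1) {{ℚ.normalize-pos (suc k) 1}} X Z (begin
    fromℤ (+ suc k) * X                          ≈⟨ pointwise-≈ (sum (replicate (suc k) X)) (fromℤ (+ suc k) * X) (λ j →
      sum-const (replicate (suc k) X) j (seq X j) (λ _ → refl)) ⟨
    -- Each shifted point is integral with coordinate sum 2s - s - s = 0, hence lies in A, and `x∈V`
    -- applies to it.
    sum (replicate (suc k) X)                    ≤⟨ sum-mono-≤ (replicate (suc k) X) Y (λ i →
      ‖‖-cancel-≤ (x -ᵥ p) (x -ᵥ shift t (u i) q) (x∈V (shift t (u i) q)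
        (shift-integral (ℤ.- s) (u i) {q} q∈ℤ ,
         ≈-trans (shift t (u i) q · 𝟏) (q · 𝟏 + t + t) 0ℝ
           (pointwise-≈ (shift t (u i) q · 𝟏) (q · 𝟏 + t + t) (weight i q t)) q·𝟏+2t≈0))) ⟩
    sum Y                                        ≤⟨ pointwise-≤ (sum Y) (sum Y + fromℚ c * (t * t)) (λ n →
      subst (ℚ._≤ seq (sum Y + fromℚ c * (t * t)) n) (ℚ.+-identityʳ (seq (sum Y) n))
        (ℚ.+-monoʳ-≤ (seq (sum Y) n) (Defs.*-mono-≤ {0ℚ} {c} {0ℚ} 0≤c ℚ.≤-refl 0≤c (0≤p² (seq t n))))) ⟩
    sum Y + fromℚ c * (t * t)                    ≈⟨ pointwise-≈
      (sum Y + fromℚ c * (t * t)) (fromℤ (+ suc k) * Z + fromℚ r * (t * e)) (mean x q t) ⟩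
    fromℤ (+ suc k) * Z + fromℚ r * (t * e)      ≈⟨ +-congˡ (fromℤ (+ suc k) * Z) (fromℚ r * (t * e)) 0ℝ
      (*-zeroʳ-≈ (fromℚ r) (t * e) (*-zeroʳ-≈ t e e≈0)) ⟩
    fromℤ (+ suc k) * Z + 0ℝ                     ≈⟨ pointwise-≈ (fromℤ (+ suc k) * Z + 0ℝ) (fromℤ (+ suc k) * Z)
      (λ n → ℚ.+-identityʳ ((+ suc k ℚ./ 1) ℚ.* seq Z n)) ⟩
    fromℤ (+ suc k) * Z                          ∎))
  where
  open ≤-Reasoning
  X Z t e : ℝ
  X = (x -ᵥ p) · (x -ᵥ p)
  Z = (x -ᵥ q) · (x -ᵥ q)
  t = fromℤ (ℤ.- s)
  e = q · 𝟏 + t + t - x · 𝟏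
  Y : ℝ^ suc k
  Y i = (x -ᵥ shift t (u i) q) · (x -ᵥ shift t (u i) q)
  q·𝟏+2t≈0 : q · 𝟏 + t + t ≈ 0ℝ
  q·𝟏+2t≈0 = ≈-trans (q · 𝟏 + t + t) (fromℤ (+ 2 ℤ.* s) + t + t) 0ℝ
    (+-cong (q · 𝟏 + t) (fromℤ (+ 2 ℤ.* s) + t) t t
      (+-cong (q · 𝟏) (fromℤ (+ 2 ℤ.* s)) t t q·𝟏≈2s (≈-refl t)) (≈-refl t))
    (2s-s-s≈0 s)
  e≈0 : e ≈ 0ℝ
  -- The terms of `0ℝ + - 0ℝ` compute to `0ℚ`, and `_≈_` sees only the terms.
  e≈0 = +-cong (q · 𝟏 + t + t) 0ℝ (- (x · 𝟏)) (- 0ℝ) q·𝟏+2t≈0 (neg-cong (x · 𝟏) 0ℝ x∈H)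

-- Syntactic copies of the expressions in averaging, so that its hypotheses can
-- be given to the ring solver for concrete dimensions.
module _ {v m : ℕ} where
  sumₚ : ∀ {l} → Vector (Polynomial v) l → Polynomial v
  sumₚ = foldr _:+_ (con 0ℚ)

  _·𝟏ₚ : Vector (Polynomial v) m → Polynomial v
  x ·𝟏ₚ = sumₚ (λ i → x i :* con 1ℚ)

  shiftₚ : Polynomial v → Vector Bool m → Vector (Polynomial v) m → Vector (Polynomial v) m
  shiftₚ t u q i = q i :+ (if u i then t else con 0ℚ)

  distₚ : Vector (Polynomial v) m → Vector (Polynomial v) m → Polynomial v
  distₚ x y = sumₚ (λ i → (x i :- y i) :* (x i :- y i))

  weightₚ : Vector Bool m → Vector (Polynomial v) m → Polynomial v →
    Polynomial v × Polynomial v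
  weightₚ u q t = shiftₚ t u q ·𝟏ₚ := q ·𝟏ₚ :+ t :+ t

  meanₚ : ∀ {k} → (Fin (suc k) → Vector Bool m) → ℚ → ℚ →
    Vector (Polynomial v) m → Vector (Polynomial v) m → Polynomial v →
    Polynomial v × Polynomial v
  meanₚ {k} u c r x q t =
    sumₚ (λ i → distₚ x (shiftₚ t (u i) q)) :+ con c :* (t :* t)
    := con (+ suc k ℚ./ 1) :* distₚ x q :+ con r :* (t :* (q ·𝟏ₚ :+ t :+ t :- x ·𝟏ₚ))

2ℚ 4ℚ : ℚ
2ℚ = + 2 ℚ./ 1
4ℚ = + 4 ℚ./ 1

-- Origin of the constants here and in the next two lemmas: let N pairs cover each of m = n + 1
-- coordinates equally often. Expanding the squares and replacing x · 𝟏 - q · 𝟏 by 2t - e, with e =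
-- q · 𝟏 + 2t - x · 𝟏, gives c = N (8/m - 2) and r = 4N/m. For m = 2 there is one pair.
V⊆V-D₁ : ∀ p → V 1 p ⊆ V-D (suc 1) p
V⊆V-D₁ = averaging {1} {0} u 2ℚ 2ℚ (ℚ.nonNegative⁻¹ 2ℚ)
  (λ { zero q t j → solve 3 (λ q₀ q₁ → weightₚ (u zero) (q₀ ∷ q₁ ∷ [])) refl
         (seq (q zero) j) (seq (q (suc zero)) j) (seq t j) })
  λ x q t j → solve 5
    (λ x₀ x₁ q₀ q₁ → meanₚ u 2ℚ 2ℚ (x₀ ∷ x₁ ∷ []) (q₀ ∷ q₁ ∷ [])) refl
    (seq (x zero) j) (seq (x (suc zero)) j) (seq (q zero) j) (seq (q (suc zero)) j) (seq t j)
  where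
  u : Fin 1 → Vector Bool 2
  u = (true ∷ true ∷ []) ∷ []

V⊆V-D₂ : ∀ p → V 2 p ⊆ V-D (suc 2) p
V⊆V-D₂ = averaging {2} {2} u 2ℚ 4ℚ (ℚ.nonNegative⁻¹ 2ℚ)
  (λ { zero             q t j → solve 4 (λ q₀ q₁ q₂ → weightₚ (u zero) (q₀ ∷ q₁ ∷ q₂ ∷ [])) refl
         (seq (q zero) j) (seq (q (suc zero)) j) (seq (q (suc (suc zero))) j) (seq t j)
     ; (suc zero)       q t j → solve 4 (λ q₀ q₁ q₂ → weightₚ (u (suc zero)) (q₀ ∷ q₁ ∷ q₂ ∷ [])) refl
         (seq (q zero) j) (seq (q (suc zero)) j) (seq (q (suc (suc zero))) j) (seq t j)
     ; (suc (suc zero)) q t j → solve 4 (λ q₀ q₁ q₂ → weightₚ (u (suc (suc zero))) (q₀ ∷ q₁ ∷ q₂ ∷ [])) refl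
         (seq (q zero) j) (seq (q (suc zero)) j) (seq (q (suc (suc zero))) j) (seq t j) })
  λ x q t j → solve 7
    (λ x₀ x₁ x₂ q₀ q₁ q₂ → meanₚ u 2ℚ 4ℚ (x₀ ∷ x₁ ∷ x₂ ∷ []) (q₀ ∷ q₁ ∷ q₂ ∷ [])) refl
    (seq (x zero) j) (seq (x (suc zero)) j) (seq (x (suc (suc zero))) j)
    (seq (q zero) j) (seq (q (suc zero)) j) (seq (q (suc (suc zero))) j) (seq t j)
  where
  u : Fin 3 → Vector Bool 3
  -- All three pairs of coordinates, each omitting one.
  u = (false ∷ true ∷ true ∷ []) ∷ (true ∷ false ∷ true ∷ []) ∷ (true ∷ true ∷ false ∷ []) ∷ []

-- The limiting case m = 4, where c = 0: when e vanishes, the mean square distance to the shifted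
-- points equals that to q. Two complementary pairs already cover the coordinates evenly.
V⊆V-D₃ : ∀ p → V 3 p ⊆ V-D (suc 3) p
V⊆V-D₃ = averaging {3} {1} u 0ℚ 2ℚ ℚ.≤-refl
  (λ { zero q t j → solve 5
         (λ q₀ q₁ q₂ q₃ → weightₚ (u zero) (q₀ ∷ q₁ ∷ q₂ ∷ q₃ ∷ [])) refl
         (seq (q zero) j) (seq (q (suc zero)) j)
         (seq (q (suc (suc zero))) j) (seq (q (suc (suc (suc zero)))) j) (seq t j)
     ; (suc zero) q t j → solve 5
         (λ q₀ q₁ q₂ q₃ → weightₚ (u (suc zero)) (q₀ ∷ q₁ ∷ q₂ ∷ q₃ ∷ [])) refl
         (seq (q zero) j) (seq (q (suc zero)) j)
         (seq (q (suc (suc zero))) j) (seq (q (suc (suc (suc zero)))) j) (seq t j) })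
  λ x q t j → solve 9
    (λ x₀ x₁ x₂ x₃ q₀ q₁ q₂ q₃ →
      meanₚ u 0ℚ 2ℚ (x₀ ∷ x₁ ∷ x₂ ∷ x₃ ∷ []) (q₀ ∷ q₁ ∷ q₂ ∷ q₃ ∷ [])) refl
    (seq (x zero) j) (seq (x (suc zero)) j)
    (seq (x (suc (suc zero))) j) (seq (x (suc (suc (suc zero)))) j)
    (seq (q zero) j) (seq (q (suc zero)) j)
    (seq (q (suc (suc zero))) j) (seq (q (suc (suc (suc zero)))) j) (seq t j)
  where
  u : Fin 2 → Vector Bool 4
  u = (true ∷ true ∷ false ∷ false ∷ []) ∷ (false ∷ false ∷ true ∷ true ∷ []) ∷ []

-- The counterexample for n ≥ 4.

-- z² + z = z (z + 1), and no integer lies strictly between -1 and 0, so the two factors never have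
-- opposite signs.
0≤z²+z : ∀ z → 0ℚ ℚ.≤ (z ℚ./ 1) ℚ.* (z ℚ./ 1) ℚ.+ z ℚ./ 1
0≤z²+z (+ k) = ℚ.+-mono-≤ (0≤p² (+ k ℚ./ 1)) (0≤grid 0 k)
0≤z²+z z@(-[1+ k ]) = subst (0ℚ ℚ.≤_)
  (solve 1 (λ r → :- r :* :- (r :+ con 1ℚ) := r :* r :+ r) refl r)
  (Defs.*-mono-≤ {0ℚ} {ℚ.- r} {0ℚ} 0≤-r ℚ.≤-refl 0≤-r 0≤-[r+1])
  where
  r : ℚ
  r = z ℚ./ 1
  r≤-1 : r ℚ.≤ ℚ.- 1ℚ
  r≤-1 = fromℚᵘ-mono-≤ {mkℚᵘ z 0} {mkℚᵘ -[1+ 0 ] 0}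
    (ℚᵘ.*≤* (ℤ.*-monoʳ-≤-nonNeg (+ 1) {z} { -[1+ 0 ]} (ℤ.-≤- ℕ.z≤n)))
  0≤-r : 0ℚ ℚ.≤ ℚ.- r
  0≤-r = ℚ.neg-antimono-≤ (ℚ.≤-trans r≤-1 (ℚ.nonPositive⁻¹ (ℚ.- 1ℚ)))
  0≤-[r+1] : 0ℚ ℚ.≤ ℚ.- (r ℚ.+ 1ℚ)
  0≤-[r+1] = ℚ.neg-antimono-≤ (ℚ.+-monoˡ-≤ 1ℚ r≤-1)

-- The vector e₀ + e₁, with coordinate sum 2: a point of D outside H.
pair : ∀ {k} → Vector ℤ (suc (suc k))
pair zero          = + 1
pair (suc zero)    = + 1
pair (suc (suc _)) = + 0

-- With u the entry of `pair`, the expression z² + z - 2uz is z² + z for u = 0 and z² - z = (z - 1)²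
-- + (z - 1) for u = 1, so `0≤z²+z` applies at z or at z - 1.
pair-bound : ∀ {k} (i : Fin (suc (suc k))) z →
  0ℚ ℚ.≤ (z ℚ./ 1) ℚ.* (z ℚ./ 1) ℚ.+ z ℚ./ 1 ℚ.- 2ℚ ℚ.* (pair i ℚ./ 1) ℚ.* (z ℚ./ 1)
pair-bound zero z = subst (0ℚ ℚ.≤_)
  (trans (cong (λ s → s ℚ.* s ℚ.+ s) (/1-homo-+ z -[1+ 0 ]))
    (solve 1 (λ r → (r :+ con (ℚ.- 1ℚ)) :* (r :+ con (ℚ.- 1ℚ)) :+ (r :+ con (ℚ.- 1ℚ))
      := r :* r :+ r :- con 2ℚ :* con 1ℚ :* r) refl (z ℚ./ 1)))
  (0≤z²+z (z ℤ.+ -[1+ 0 ]))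
-- The bound depends on i only through `pair i`, which is the same at the first two coordinates.
pair-bound (suc zero) z = pair-bound {0} zero z
pair-bound (suc (suc _)) z = subst (0ℚ ℚ.≤_)
  (solve 1 (λ r → r :* r :+ r := r :* r :+ r :- con 2ℚ :* con 0ℚ :* r) refl (z ℚ./ 1))
  (0≤z²+z z)

-- The point e₀ + e₁ - c 𝟏. `c` stays a parameter: (n + 1) c = 2 puts the point into H and into
-- V(0), while 2c < 1 keeps it out of the cell of D.
apex : ∀ {k} → ℚ → ℝ^ suc (suc k)
apex c i = fromℚ (pair i ℚ./ 1 ℚ.- c)

origin : ∀ {m} → ℝ^ m
origin _ = 0ℝ

origin·𝟏≈0 : ∀ m → origin {m} · 𝟏 ≈ 0ℝ
origin·𝟏≈0 m = pointwise-≈ (origin {m} · 𝟏) 0ℝ λ j →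
  trans (sum-const (zipWith _*_ (origin {m}) 𝟏) j 0ℚ (λ _ → refl)) (ℚ.*-zeroʳ (+ m ℚ./ 1))

origin∈A : ∀ n → origin ∈ A n
origin∈A n = ((λ _ → + 0) , λ _ → ≈-refl 0ℝ) , origin·𝟏≈0 (suc n)

apex∈H : ∀ k c → (2ℚ ℚ.+ + k ℚ./ 1) ℚ.* c ≡ 2ℚ → apex c ∈ H (suc k)
apex∈H k c eq = pointwise-≈ (apex {k} c · 𝟏) 0ℝ λ j → trans
  (sum-const₂ (zipWith _*_ (apex {k} c) 𝟏) j (1ℚ ℚ.- c) (0ℚ ℚ.- c)
    (ℚ.*-identityʳ (1ℚ ℚ.- c)) (ℚ.*-identityʳ (1ℚ ℚ.- c)) (λ _ → ℚ.*-identityʳ (0ℚ ℚ.- c)))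
  (trans (solve 2 (λ c r → (con 1ℚ :- c) :+ ((con 1ℚ :- c) :+ r :* (con 0ℚ :- c))
      := con 2ℚ :- (con 2ℚ :+ r) :* c) refl c (+ k ℚ./ 1))
    (cong (λ s → 2ℚ ℚ.- s) eq))

-- (u - c - z)² - (u - c)² = (2c - 1) z + (z² + z - 2uz), and the last bracket is nonnegative by
-- hypothesis. The linear term is kept on the left because its sum over all coordinates is a
-- multiple of q · 𝟏, which vanishes for q in A.
coordinate-≤ : ∀ u c z q →
  0ℚ ℚ.≤ (z ℚ./ 1) ℚ.* (z ℚ./ 1) ℚ.+ z ℚ./ 1 ℚ.- 2ℚ ℚ.* u ℚ.* (z ℚ./ 1) → q ≈ fromℤ z →
  let x = fromℚ (u ℚ.- c) in
  (x - 0ℝ) * (x - 0ℝ) + fromℚ (c ℚ.+ c ℚ.- 1ℚ) * (q * 1ℝ) ≤ (x - q) * (x - q)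
coordinate-≤ u c z q h q≈z = begin
  w + d * (q * 1ℝ)   ≈⟨ +-congˡ w (d * (q * 1ℝ)) (d * (ζ * 1ℝ))
    (*-congˡ d (q * 1ℝ) (ζ * 1ℝ) (*-cong q ζ 1ℝ 1ℝ q≈z (≈-refl 1ℝ))) ⟩
  w + d * (ζ * 1ℝ)   ≤⟨ pointwise-≤ (w + d * (ζ * 1ℝ)) ((x - ζ) * (x - ζ)) (λ _ →
    rational (z ℚ./ 1) h) ⟩
  (x - ζ) * (x - ζ)  ≈⟨ *-cong (x - q) (x - ζ) (x - q) (x - ζ) x-q≈x-ζ x-q≈x-ζ ⟨
  (x - q) * (x - q)  ∎
  where
  open ≤-Reasoning
  x d w ζ : ℝ
  x = fromℚ (u ℚ.- c)
  d = fromℚ (c ℚ.+ c ℚ.- 1ℚ)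
  w = (x - 0ℝ) * (x - 0ℝ)
  ζ = fromℤ z
  x-q≈x-ζ : x - q ≈ x - ζ
  x-q≈x-ζ = +-congˡ x (- q) (- ζ) (neg-cong q ζ q≈z)

  rational : ∀ r → 0ℚ ℚ.≤ r ℚ.* r ℚ.+ r ℚ.- 2ℚ ℚ.* u ℚ.* r →
    (u ℚ.- c ℚ.- 0ℚ) ℚ.* (u ℚ.- c ℚ.- 0ℚ) ℚ.+ (c ℚ.+ c ℚ.- 1ℚ) ℚ.* (r ℚ.* 1ℚ)
      ℚ.≤ (u ℚ.- c ℚ.- r) ℚ.* (u ℚ.- c ℚ.- r)
  rational r h = subst₂ ℚ._≤_ (ℚ.+-identityʳ _)
    (solve 3 (λ u c r →
      ((u :- c :- con 0ℚ) :* (u :- c :- con 0ℚ) :+ (c :+ c :- con 1ℚ) :* (r :* con 1ℚ))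
        :+ (r :* r :+ r :- con 2ℚ :* u :* r)
      := (u :- c :- r) :* (u :- c :- r)) refl u c r)
    (ℚ.+-monoʳ-≤ ((u ℚ.- c ℚ.- 0ℚ) ℚ.* (u ℚ.- c ℚ.- 0ℚ) ℚ.+ (c ℚ.+ c ℚ.- 1ℚ) ℚ.* (r ℚ.* 1ℚ)) h)

sum-affine : ∀ {m} p (u v w : ℝ^ m) j →
  (∀ i → seq (u i) j ≡ seq (v i) j ℚ.+ p ℚ.* seq (w i) j) →
  seq (sum u) j ≡ seq (sum v) j ℚ.+ p ℚ.* seq (sum w) j
sum-affine {ℕ.zero} p u v w j h = sym (cong (0ℚ ℚ.+_) (ℚ.*-zeroʳ p))
sum-affine {suc m}  p u v w j h = trans
  (cong₂ ℚ._+_ (h zero) (sum-affine p (λ i → u (suc i)) (λ i → v (suc i)) (λ i → w (suc i)) j (λ i → h (suc i))))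
  (solve 5 (λ v w p r s → (v :+ p :* w) :+ (r :+ p :* s) := (v :+ r) :+ p :* (w :+ s)) refl
    (seq (v zero) j) (seq (w zero) j) p
    (seq (sum (λ i → v (suc i))) j) (seq (sum (λ i → w (suc i))) j))

-- Any multiple of q · 𝟏 ≈ 0 may be added to make the comparison hold coordinate
-- by coordinate.
sum-mono-≤-mod : ∀ {m} d (v w q : ℝ^ m) → q · 𝟏 ≈ 0ℝ →
  (∀ i → v i + d * (q i * 1ℝ) ≤ w i) → sum v ≤ sum w
sum-mono-≤-mod d v w q q·𝟏≈0 h = begin
  sum v                             ≈⟨ pointwise-≈ (sum v) (sum v + 0ℝ)
    (λ j → sym (ℚ.+-identityʳ (seq (sum v) j))) ⟩
  sum v + 0ℝ                        ≈⟨ +-congˡ (sum v) (d * (q · 𝟏)) 0ℝ (*-zeroʳ-≈ d (q · 𝟏) q·𝟏≈0) ⟨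
  sum v + d * (q · 𝟏)               ≈⟨ pointwise-≈ (sum (λ i → v i + d * (q i * 1ℝ)))
    (sum v + d * (q · 𝟏)) (λ j →
      sum-affine (seq d j) (λ i → v i + d * (q i * 1ℝ)) v (zipWith _*_ q 𝟏) j (λ _ → refl)) ⟨
  sum (λ i → v i + d * (q i * 1ℝ))  ≤⟨ sum-mono-≤ (λ i → v i + d * (q i * 1ℝ)) w h ⟩
  sum w                             ∎
  where open ≤-Reasoning

apex∈V : ∀ k c → (2ℚ ℚ.+ + k ℚ./ 1) ℚ.* c ≡ 2ℚ → apex c ∈ V (suc k) origin
apex∈V k c eq = apex∈H k c eq , λ q ((z , q≈z) , q·𝟏≈0) →
  ‖‖-mono-≤ (x -ᵥ origin) (x -ᵥ q) (sum-mono-≤-mod (fromℚ (c ℚ.+ c ℚ.- 1ℚ))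
    (zipWith _*_ (x -ᵥ origin) (x -ᵥ origin)) (zipWith _*_ (x -ᵥ q) (x -ᵥ q)) q q·𝟏≈0
    λ i → coordinate-≤ (pair i ℚ./ 1) c (z i) (q i) (pair-bound i (z i)) (q≈z i))
  where
  x : ℝ^ suc (suc k)
  x = apex c

pair∈D : ∀ k → (fromℤ ∘ pair) ∈ D (suc (suc k))
pair∈D k = (pair , λ i → ≈-refl (fromℤ (pair i))) , + 1 ,
  pointwise-≈ ((fromℤ ∘ pair {k}) · 𝟏) (fromℤ (+ 2)) λ j → trans
    (sum-const₂ (zipWith _*_ (fromℤ ∘ pair {k}) 𝟏) j 1ℚ 0ℚ refl refl (λ _ → refl))
    (solve 1 (λ r → con 1ℚ :+ (con 1ℚ :+ r :* con 0ℚ) := con 2ℚ) refl (+ k ℚ./ 1))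

-- The k coordinates outside the pair contribute k c² to both squared distances. The other two give
-- 2 (1 - c)² from the origin and 2c² from e₀ + e₁.
apex∉V-D : ∀ k c → c ℚ.+ c ℚ.< 1ℚ → ¬ (apex c ∈ V-D (suc (suc k)) origin)
apex∉V-D k c 2c<1 x∈V-D =
  let N , h = x·x≤y·y ε 0<ε in
  contradiction (ℚ.<-≤-trans 0<ε (gap ((+ k ℚ./ 1) ℚ.* (c ℚ.* c))
    (subst₂ (λ a b → a ℚ.≤ b ℚ.+ ε) (x·x N) (y·y N) (h N ℕ.≤-refl)))) (ℚ.<-irrefl refl)
  where
  x y : ℝ^ suc (suc k)
  x = apex c -ᵥ origin
  y = apex c -ᵥ (fromℤ ∘ pair)

  x·x≤y·y : x · x ≤ y · y
  x·x≤y·y = ‖‖-cancel-≤ x y (x∈V-D (fromℤ ∘ pair) (pair∈D k))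

  0-c-0 : (0ℚ ℚ.- c ℚ.- 0ℚ) ℚ.* (0ℚ ℚ.- c ℚ.- 0ℚ) ≡ c ℚ.* c
  0-c-0 = solve 1 (λ c → (con 0ℚ :- c :- con 0ℚ) :* (con 0ℚ :- c :- con 0ℚ) := c :* c) refl c

  1-c-0 : (1ℚ ℚ.- c ℚ.- 0ℚ) ℚ.* (1ℚ ℚ.- c ℚ.- 0ℚ) ≡ (1ℚ ℚ.- c) ℚ.* (1ℚ ℚ.- c)
  1-c-0 = solve 1 (λ c → (con 1ℚ :- c :- con 0ℚ) :* (con 1ℚ :- c :- con 0ℚ)
    := (con 1ℚ :- c) :* (con 1ℚ :- c)) refl c

  1-c-1 : (1ℚ ℚ.- c ℚ.- 1ℚ) ℚ.* (1ℚ ℚ.- c ℚ.- 1ℚ) ≡ c ℚ.* c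
  1-c-1 = solve 1 (λ c → (con 1ℚ :- c :- con 1ℚ) :* (con 1ℚ :- c :- con 1ℚ) := c :* c) refl c

  x·x : ∀ j → seq (x · x) j
    ≡ (1ℚ ℚ.- c) ℚ.* (1ℚ ℚ.- c) ℚ.+ ((1ℚ ℚ.- c) ℚ.* (1ℚ ℚ.- c) ℚ.+ (+ k ℚ./ 1) ℚ.* (c ℚ.* c))
  x·x j = sum-const₂ (zipWith _*_ x x) j ((1ℚ ℚ.- c) ℚ.* (1ℚ ℚ.- c)) (c ℚ.* c)
    1-c-0 1-c-0 (λ _ → 0-c-0)

  y·y : ∀ j → seq (y · y) j ≡ c ℚ.* c ℚ.+ (c ℚ.* c ℚ.+ (+ k ℚ./ 1) ℚ.* (c ℚ.* c))
  y·y j = sum-const₂ (zipWith _*_ y y) j (c ℚ.* c) (c ℚ.* c) 1-c-1 1-c-1 (λ _ → 0-c-0)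

  -- Half of the gap 2 (1 - c)² - 2c² = 2 (1 - 2c): an inequality with this tolerance would force ε
  -- ≤ 0.
  ε : ℚ
  ε = 1ℚ ℚ.- (c ℚ.+ c)

  0<ε : 0ℚ ℚ.< ε
  0<ε = subst (ℚ._< ε) (ℚ.+-inverseʳ (c ℚ.+ c)) (ℚ.+-monoˡ-< (ℚ.- (c ℚ.+ c)) 2c<1)

  gap : ∀ t → let s = (1ℚ ℚ.- c) ℚ.* (1ℚ ℚ.- c) in
    s ℚ.+ (s ℚ.+ t) ℚ.≤ c ℚ.* c ℚ.+ (c ℚ.* c ℚ.+ t) ℚ.+ ε → ε ℚ.≤ 0ℚ
  gap t h = subst₂ ℚ._≤_
    (solve 2 (λ c t → let s = (con 1ℚ :- c) :* (con 1ℚ :- c) ; b = c :* c :+ (c :* c :+ t) in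
      (s :+ (s :+ t)) :- (b :+ (con 1ℚ :- (c :+ c))) := con 1ℚ :- (c :+ c)) refl c t)
    (ℚ.+-inverseʳ b) (ℚ.+-monoˡ-≤ (ℚ.- b) h)
    where
    b : ℚ
    b = c ℚ.* c ℚ.+ (c ℚ.* c ℚ.+ t) ℚ.+ ε

-- Here n = 4 + k, and c = 2 / (n + 1).
apex-constant : ∀ k → ∃ λ c → (2ℚ ℚ.+ + suc (suc (suc k)) ℚ./ 1) ℚ.* c ≡ 2ℚ × c ℚ.+ c ℚ.< 1ℚ
apex-constant k = c , trans (cong (ℚ._* c) (sym (/1-homo-+ (+ 2) (+ (suc (suc (suc k))))))) rc≡2
  -- Multiplied by r = n + 1 = 5 + k, the claim 2c < 1 reads 4 < 5 + k, as r c = 2.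
  , ℚ.*-cancelˡ-<-nonNeg r {{ℚ.pos⇒nonNeg r}} (subst₂ ℚ._<_
      (trans (cong₂ ℚ._+_ (sym rc≡2) (sym rc≡2)) (sym (ℚ.*-distribˡ-+ r c c)))
      (trans (sym (/1-homo-+ (+ 5) (+ k))) (sym (ℚ.*-identityʳ r)))
      (ℚ.+-mono-<-≤ {4ℚ} {+ 5 ℚ./ 1} {0ℚ} (ℚ.*<* (ℤ.+<+ (ℕ.s≤s (ℕ.s≤s (ℕ.s≤s (ℕ.s≤s (ℕ.s≤s ℕ.z≤n)))))))
        (0≤grid 0 k)))
  where
  r : ℚ
  r = + (suc (suc (suc (suc (suc k))))) ℚ./ 1
  instance
    r-positive : ℚ.Positive r
    r-positive = ℚ.normalize-pos (suc (suc (suc (suc (suc k))))) 1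
    r-nonZero : ℚ.NonZero r
    r-nonZero = ℚ.pos⇒nonZero r
  c : ℚ
  c = ℚ.1/ r ℚ.* 2ℚ
  rc≡2 : r ℚ.* c ≡ 2ℚ
  rc≡2 = trans (sym (ℚ.*-assoc r (ℚ.1/ r) 2ℚ))
    (trans (cong (ℚ._* 2ℚ) (ℚ.*-inverseʳ r)) (ℚ.*-identityˡ 2ℚ))

V⊈V-D : ∀ k → ¬ (V (suc (suc (suc (suc k)))) origin ⊆ V-D (suc (suc (suc (suc (suc k))))) origin)
V⊈V-D k V⊆V-D =
  let c , eq , 2c<1 = apex-constant k
  in apex∉V-D (suc (suc (suc k))) c 2c<1 (V⊆V-D {apex c} (apex∈V (suc (suc (suc k))) c eq))

-- The equivalence.

V≐V-D∩H : ∀ n → (∀ p → V n p ⊆ V-D (suc n) p) → ∀ p → p ∈ A n → V n p ≐ (V-D (suc n) p ∩ H n)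
V≐V-D∩H n V⊆V-D p _ = (λ {x} x∈V → V⊆V-D p {x} x∈V , proj₁ x∈V) , λ {x} → V-D∩H⊆V n p {x}

lemma12 : ∀ (n : ℕ) → n ≥ 1 →
    (∀ p → p ∈ A n → V n p ≐ (V-D (suc n) p ∩ H n)) ⇔ (n ≡ 1 ⊎ n ≡ 2 ⊎ n ≡ 3)
lemma12 n n≥1 = mk⇔ (only-if n n≥1)
  λ { (inj₁ refl)        → V≐V-D∩H 1 λ p {x} → V⊆V-D₁ p {x}
    ; (inj₂ (inj₁ refl)) → V≐V-D∩H 2 λ p {x} → V⊆V-D₂ p {x}
    ; (inj₂ (inj₂ refl)) → V≐V-D∩H 3 λ p {x} → V⊆V-D₃ p {x} }
  where
  only-if : ∀ n → n ≥ 1 → (∀ p → p ∈ A n → V n p ≐ (V-D (suc n) p ∩ H n)) →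
    n ≡ 1 ⊎ n ≡ 2 ⊎ n ≡ 3
  only-if 1 _ _ = inj₁ refl
  only-if 2 _ _ = inj₂ (inj₁ refl)
  only-if 3 _ _ = inj₂ (inj₂ refl)
  only-if (suc (suc (suc (suc k)))) _ h = contradiction
    (λ {x} x∈V → proj₁ (proj₁ (h origin (origin∈A (suc (suc (suc (suc k)))))) {x} x∈V)) (V⊈V-D k)
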